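{- Let $\lambda$ be a nonzero real number and let $n,r$ be positive integers. Then $$\sum_{k=1}^{n}(-1)^{k}H_{k,\lambda}^{(r)}\,k!\,S_{2,\lambda}(n,k)=(-1)^{n}\langle r\rangle_{n-1,\lambda}\,n.$$ In particular, for $r=1$ (provided $\langle 1\rangle_{n-1,\lambda}\neq 0$), $$\frac{1}{\langle 1\rangle_{n-1,\lambda}}\sum_{k=1}^{n}(-1)^{n-k}H_{k,\lambda}\,k!\,S_{2,\lambda}(n,k)=n.$$
   Context: For real $x$ and integer $k\ge0$: $(x)_{0,\lambda}=1$, $(x)_{k,\lambda}=x(x-\lambda)\cdots(x-(k-1)\lambda)$; $\langle x\rangle_{0,\lambda}=1$, $\langle x\rangle_{k,\lambda}=x(x+\lambda)\cdots(x+(k-1)\lambda)$; $(x)_0=1$, $(x)_k=x(x-1)\cdots(x-k+1)$. The degenerate Stirling numbers of the second kind $S_{2,\lambda}(n,k)$ are defined by $(x)_{n,\lambda}=\sum_{k=0}^{n}S_{2,\lambda}(n,k)(x)_{k}$ for $n\ge0$; equivalently $\frac{1}{k!}(e_\lambda(t)-1)^k=\sum_{n\ge k}S_{2,\lambda}(n,k)\frac{t^n}{n!}$, where $e_\lambda(t)=\sum_{k\ge0}(1)_{k,\lambda}t^k/k!=(1+\lambda t)^{1/\lambda}$. The degenerate harmonic numbers are $H_{0,\lambda}=0$, $H_{n,\lambda}=\sum_{k=1}^{n}\frac{1}{\lambda}\binom{\lambda}{k}(-1)^{k-1}$ for $n\ge1$; the degenerate hyperharmonic numbers are $H_{n,\lambda}^{(1)}=H_{n,\lambda}$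 and $H_{n,\lambda}^{(r)}=\sum_{k=1}^{n}H_{k,\lambda}^{(r-1)}$ for $r\ge2$. -}

module Defs where

open import Algebra.Bundles using (CommutativeRing)
open import Algebra.Structures using (IsCommutativeRing)
import Algebra.Properties.Semiring.Exp as Exp
import Algebra.Properties.Semiring.Sum as Sum
open import Data.Fin.Base using (toℕ)
import Data.Fin.Properties as Fin
open import Data.Integer.Base using (+_)
open import Data.Nat.Base as ℕ using (ℕ; zero; suc; _!; _⊔_)
import Data.Nat.Properties as ℕ
open import Data.Product.Base using (∃-syntax; _×_; _,_; proj₁; proj₂)
open import Data.Rational.Base as ℚ using (ℚ; 0ℚ; 1ℚ; ½; ∣_∣; _/_)
import Data.Rational.Properties as ℚ
open import Data.Rational.Solver using (module +-*-Solver)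
open import Level using (0ℓ)
open import Relation.Binary.PropositionalEquality using (_≡_; _≢_; refl; sym; trans; cong; cong₂; subst; subst₂)
open import Relation.Nullary using (yes; no; contradiction)

------------------------------------------------------------------------
-- Real numbers: Cauchy sequences of rationals, modulo null sequences.

IsCauchy : (ℕ → ℚ) → Set
IsCauchy x = ∀ ε → 0ℚ ℚ.< ε →
  ∃[ N ] (∀ m n → N ℕ.≤ m → N ℕ.≤ n → ∣ x m ℚ.- x n ∣ ℚ.< ε)

record ℝ : Set where
  no-eta-equality
  constructor mkℝ
  field
    seq    : ℕ → ℚ
    cauchy : IsCauchy seq

open ℝ public

infix 4 _≈_ _#_

-- A record rather than a function, so that x and y can be inferred from x ≈ y.
record _≈_ (x y : ℝ) : Set where
  constructor mk≈
  field
    close : ∀ ε → 0ℚ ℚ.< ε →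
      ∃[ N ] (∀ n → N ℕ.≤ n → ∣ seq x n ℚ.- seq y n ∣ ℚ.< ε)

open _≈_ public

-- Apartness, the constructive form of "x and y are different".
_#_ : ℝ → ℝ → Set
x # y = ∃[ δ ] (0ℚ ℚ.< δ ×
  ∃[ N ] (∀ n → N ℕ.≤ n → δ ℚ.≤ ∣ seq x n ℚ.- seq y n ∣))

------------------------------------------------------------------------
-- Estimates on rationals

private
  open +-*-Solver using (solve; _:+_; _:*_; _:-_; :-_; _:=_)

  neg-sub : ∀ a b → a ℚ.- b ≡ ℚ.- (b ℚ.- a)
  neg-sub = solve 2 (λ a b → a :- b := :- (b :- a)) refl

  sub-neg : ∀ a b → b ℚ.- a ≡ ℚ.- a ℚ.- ℚ.- b
  sub-neg = solve 2 (λ a b → b :- a := :- a :- :- b) refl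

  sub-add : ∀ a b → (a ℚ.- b) ℚ.+ b ≡ a
  sub-add = solve 2 (λ a b → (a :- b) :+ b := a) refl

  sub-sub : ∀ a b c → (a ℚ.- b) ℚ.+ (b ℚ.- c) ≡ a ℚ.- c
  sub-sub = solve 3 (λ a b c → (a :- b) :+ (b :- c) := a :- c) refl

  sub-+ : ∀ a b c d → (a ℚ.- b) ℚ.+ (c ℚ.- d) ≡ (a ℚ.+ c) ℚ.- (b ℚ.+ d)
  sub-+ = solve 4 (λ a b c d → (a :- b) :+ (c :- d) := (a :+ c) :- (b :+ d)) refl

  sub-* : ∀ a b c d → a ℚ.* (b ℚ.- d) ℚ.+ d ℚ.* (a ℚ.- c) ≡ a ℚ.* b ℚ.- c ℚ.* d
  sub-* = solve 4 (λ a b c d → a :* (b :- d) :+ d :* (a :- c) := a :* b :- c :* d) refl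

  sub-recip : ∀ a b r s → (a ℚ.* b) ℚ.* (r ℚ.- s) ≡ (a ℚ.* r) ℚ.* b ℚ.- (b ℚ.* s) ℚ.* a
  sub-recip = solve 4 (λ a b r s → (a :* b) :* (r :- s) := (a :* r) :* b :- (b :* s) :* a) refl

  recip : ℚ → ℚ
  recip q with q ℚ.≟ 0ℚ
  ... | yes _   = 0ℚ
  ... | no  q≢0 = (ℚ.1/ q) {{ℚ.≢-nonZero q≢0}}

  recip-inverse : ∀ {q} → q ≢ 0ℚ → q ℚ.* recip q ≡ 1ℚ
  recip-inverse {q} q≢0 with q ℚ.≟ 0ℚ
  ... | yes q≡0 = contradiction q≡0 q≢0
  ... | no  p   = ℚ.*-inverseʳ q {{ℚ.≢-nonZero p}}

  pos* : ∀ {p q} → 0ℚ ℚ.< p → 0ℚ ℚ.< q → 0ℚ ℚ.< p ℚ.* q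
  pos* {p} {q} 0<p 0<q = ℚ.positive⁻¹ (p ℚ.* q)
    {{ℚ.pos*pos⇒pos p {{ℚ.positive 0<p}} q {{ℚ.positive 0<q}}}}

  pos-recip : ∀ {q} → 0ℚ ℚ.< q → 0ℚ ℚ.< recip q
  pos-recip {q} 0<q with q ℚ.≟ 0ℚ
  ... | yes q≡0 = contradiction (sym q≡0) (ℚ.<⇒≢ 0<q)
  ... | no  p   = ℚ.positive⁻¹ _ {{ℚ.1/pos⇒pos q {{ℚ.positive 0<q}}}}

  half : ℚ → ℚ
  half ε = ½ ℚ.* ε

  0<half : ∀ {ε} → 0ℚ ℚ.< ε → 0ℚ ℚ.< half ε
  0<half = pos* (ℚ.positive⁻¹ ½)

  half+half : ∀ ε → half ε ℚ.+ half ε ≡ ε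
  half+half ε = trans (sym (ℚ.*-distribʳ-+ ε ½ ½)) (trans (cong (ℚ._* ε) ½+½≡1) (ℚ.*-identityˡ ε))
    where
    ½+½≡1 : ½ ℚ.+ ½ ≡ 1ℚ
    ½+½≡1 = refl

  ∣p-q∣≡∣q-p∣ : ∀ p q → ∣ p ℚ.- q ∣ ≡ ∣ q ℚ.- p ∣
  ∣p-q∣≡∣q-p∣ p q = trans
    (cong ∣_∣ (neg-sub p q))
    (ℚ.∣-p∣≡∣p∣ (q ℚ.- p))

  sum-bound : ∀ {ε} p q → ∣ p ∣ ℚ.< half ε → ∣ q ∣ ℚ.< half ε → ∣ p ℚ.+ q ∣ ℚ.< ε
  sum-bound {ε} p q p< q< = ℚ.≤-<-trans (ℚ.∣p+q∣≤∣p∣+∣q∣ p q)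
    (subst (_ ℚ.<_) (half+half ε) (ℚ.+-mono-< p< q<))

  ∣p-p∣<ε : ∀ {ε} p → 0ℚ ℚ.< ε → ∣ p ℚ.- p ∣ ℚ.< ε
  ∣p-p∣<ε p 0<ε = subst (ℚ._< _) (sym (cong ∣_∣ (ℚ.+-inverseʳ p))) 0<ε

  scale : ℚ → ℚ → ℚ
  scale B ε = recip B ℚ.* ε

  0<scale : ∀ {B ε} → 0ℚ ℚ.< B → 0ℚ ℚ.< ε → 0ℚ ℚ.< scale B ε
  0<scale 0<B 0<ε = pos* (pos-recip 0<B) 0<ε

  *-bound : ∀ {B ε} p q → 0ℚ ℚ.< B → ∣ p ∣ ℚ.≤ B → ∣ q ∣ ℚ.< scale B ε → ∣ p ℚ.* q ∣ ℚ.< ε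
  *-bound {B} {ε} p q 0<B p≤ q< = subst₂ ℚ._<_ (sym (ℚ.∣p*q∣≡∣p∣*∣q∣ p q)) eq
    (ℚ.≤-<-trans
      (ℚ.*-monoʳ-≤-nonNeg ∣ q ∣ {{ℚ.∣-∣-nonNeg q}} p≤)
      (ℚ.*-monoʳ-<-pos B {{ℚ.positive 0<B}} q<))
    where
    eq : B ℚ.* scale B ε ≡ ε
    eq = trans (sym (ℚ.*-assoc B (recip B) ε))
      (trans (cong (ℚ._* ε) (recip-inverse (λ B≡0 → ℚ.<⇒≢ 0<B (sym B≡0)))) (ℚ.*-identityˡ ε))

  product-bound : ∀ {A D ε} a b c d → 0ℚ ℚ.< A → 0ℚ ℚ.< D → ∣ a ∣ ℚ.≤ A → ∣ d ∣ ℚ.≤ D →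
    ∣ a ℚ.- c ∣ ℚ.< scale D (half ε) → ∣ b ℚ.- d ∣ ℚ.< scale A (half ε) →
    ∣ a ℚ.* b ℚ.- c ℚ.* d ∣ ℚ.< ε
  product-bound a b c d 0<A 0<D a≤ d≤ ac bd = subst (λ q → ∣ q ∣ ℚ.< _)
    (sub-* a b c d)
    (sum-bound (a ℚ.* (b ℚ.- d)) (d ℚ.* (a ℚ.- c))
      (*-bound a (b ℚ.- d) 0<A a≤ bd) (*-bound d (a ℚ.- c) 0<D d≤ ac))

  recip-bound : ∀ {δ ε} a b → 0ℚ ℚ.< δ → δ ℚ.≤ ∣ a ∣ → δ ℚ.≤ ∣ b ∣ →
    ∣ a ℚ.- b ∣ ℚ.< (δ ℚ.* δ) ℚ.* ε → ∣ recip a ℚ.- recip b ∣ ℚ.< ε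
  recip-bound {δ} {ε} a b 0<δ δ≤a δ≤b ab =
    ℚ.*-cancelˡ-<-nonNeg (δ ℚ.* δ) {{ℚ.pos⇒nonNeg (δ ℚ.* δ) {{ℚ.positive (pos* 0<δ 0<δ)}}}}
      (ℚ.≤-<-trans
        (ℚ.*-monoʳ-≤-nonNeg ∣ d ∣ {{ℚ.∣-∣-nonNeg d}}
          (ℚ.≤-trans (ℚ.*-monoʳ-≤-nonNeg δ {{ℚ.nonNegative (ℚ.<⇒≤ 0<δ)}} δ≤a)
                     (ℚ.*-monoˡ-≤-nonNeg ∣ a ∣ {{ℚ.∣-∣-nonNeg a}} δ≤b)))
        (subst (ℚ._< _) (sym eq) ab))
    where
    d = recip a ℚ.- recip b
    nz : ∀ {q} → δ ℚ.≤ ∣ q ∣ → q ≢ 0ℚ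
    nz δ≤q refl = ℚ.<⇒≢ (ℚ.<-≤-trans 0<δ δ≤q) refl
    eq′ : (a ℚ.* b) ℚ.* d ≡ b ℚ.- a
    eq′ = trans
      (sub-recip a b (recip a) (recip b))
      (cong₂ ℚ._-_
        (trans (cong (ℚ._* b) (recip-inverse (nz δ≤a))) (ℚ.*-identityˡ b))
        (trans (cong (ℚ._* a) (recip-inverse (nz δ≤b))) (ℚ.*-identityˡ a)))
    eq : (∣ a ∣ ℚ.* ∣ b ∣) ℚ.* ∣ d ∣ ≡ ∣ a ℚ.- b ∣
    eq = trans (cong (ℚ._* ∣ d ∣) (sym (ℚ.∣p*q∣≡∣p∣*∣q∣ a b)))
      (trans (sym (ℚ.∣p*q∣≡∣p∣*∣q∣ (a ℚ.* b) d))
      (trans (cong ∣_∣ eq′) (∣p-q∣≡∣q-p∣ b a)))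

  bounded : ∀ x → ∃[ B ] (0ℚ ℚ.< B × ∃[ N ] (∀ n → N ℕ.≤ n → ∣ seq x n ∣ ℚ.≤ B))
  bounded x with cauchy x 1ℚ (ℚ.positive⁻¹ 1ℚ)
  ... | N , near = B , 0<B , N , λ n N≤n → ℚ.<⇒≤ (ℚ.≤-<-trans
          (subst (λ q → ∣ q ∣ ℚ.≤ ∣ seq x n ℚ.- seq x N ∣ ℚ.+ ∣ seq x N ∣)
            (sub-add (seq x n) (seq x N))
            (ℚ.∣p+q∣≤∣p∣+∣q∣ (seq x n ℚ.- seq x N) (seq x N)))
          (ℚ.+-mono-<-≤ (near n N N≤n ℕ.≤-refl) (ℚ.≤-refl {∣ seq x N ∣})))
    where
    B = 1ℚ ℚ.+ ∣ seq x N ∣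
    0<B : 0ℚ ℚ.< B
    0<B = ℚ.<-≤-trans (ℚ.positive⁻¹ 1ℚ)
      (ℚ.≤-trans (ℚ.≤-reflexive (sym (ℚ.+-identityʳ 1ℚ))) (ℚ.+-monoʳ-≤ 1ℚ (ℚ.0≤∣p∣ (seq x N))))

  left : ∀ m n {k} → m ⊔ n ℕ.≤ k → m ℕ.≤ k
  left m n p = ℕ.m⊔n≤o⇒m≤o m n p

  right : ∀ m n {k} → m ⊔ n ℕ.≤ k → n ℕ.≤ k
  right m n p = ℕ.m⊔n≤o⇒n≤o m n p

------------------------------------------------------------------------
-- Arithmetic

fromℚ : ℚ → ℝ
seq    (fromℚ q) _        = q
cauchy (fromℚ q) ε 0<ε = 0 , λ _ _ _ _ → ∣p-p∣<ε q 0<ε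

fromℕ : ℕ → ℝ
fromℕ n = fromℚ (+ n / 1)

0ℝ 1ℝ : ℝ
0ℝ = fromℚ 0ℚ
1ℝ = fromℚ 1ℚ

infixl 6 _+_ _-_
infixl 7 _*_
infix  8 -_

_+_ : ℝ → ℝ → ℝ
seq    (x + y) n = seq x n ℚ.+ seq y n
cauchy (x + y) ε 0<ε =
  let M , p = cauchy x (half ε) (0<half 0<ε)
      N , q = cauchy y (half ε) (0<half 0<ε)
  in M ⊔ N , λ m n ≤m ≤n → subst (λ z → ∣ z ∣ ℚ.< ε)
       (sub-+ (seq x m) (seq x n) (seq y m) (seq y n))
       (sum-bound (seq x m ℚ.- seq x n) (seq y m ℚ.- seq y n)
         (p m n (left M N ≤m) (left M N ≤n)) (q m n (right M N ≤m) (right M N ≤n)))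

-_ : ℝ → ℝ
seq    (- x) n = ℚ.- seq x n
cauchy (- x) ε 0<ε =
  let N , p = cauchy x ε 0<ε
  in N , λ m n ≤m ≤n → subst (λ z → ∣ z ∣ ℚ.< ε)
       (sub-neg (seq x m) (seq x n)) (p n m ≤n ≤m)

_-_ : ℝ → ℝ → ℝ
x - y = x + (- y)

_*_ : ℝ → ℝ → ℝ
seq    (x * y) n = seq x n ℚ.* seq y n
cauchy (x * y) ε 0<ε =
  let A , 0<A , Na , a≤ = bounded x
      D , 0<D , Nd , d≤ = bounded y
      M , p = cauchy x (scale D (half ε)) (0<scale 0<D (0<half 0<ε))
      N , q = cauchy y (scale A (half ε)) (0<scale 0<A (0<half 0<ε))
  in (Na ⊔ Nd) ⊔ (M ⊔ N) , λ m n ≤m ≤n →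
       let ≤mᵣ = right (Na ⊔ Nd) (M ⊔ N) ≤m
           ≤nᵣ = right (Na ⊔ Nd) (M ⊔ N) ≤n
       in product-bound (seq x m) (seq y m) (seq x n) (seq y n) 0<A 0<D
            (a≤ m (left Na Nd (left (Na ⊔ Nd) (M ⊔ N) ≤m)))
            (d≤ n (right Na Nd (left (Na ⊔ Nd) (M ⊔ N) ≤n)))
            (p m n (left M N ≤mᵣ) (left M N ≤nᵣ)) (q m n (right M N ≤mᵣ) (right M N ≤nᵣ))

private
  apart-bound : ∀ x (x#0 : x # 0ℝ) n → proj₁ (proj₂ (proj₂ x#0)) ℕ.≤ n → proj₁ x#0 ℚ.≤ ∣ seq x n ∣
  apart-bound x (δ , _ , N , p) n N≤n = subst (λ q → δ ℚ.≤ ∣ q ∣) (ℚ.+-identityʳ (seq x n)) (p n N≤n)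

-- The sequence n ↦ 1 / xₙ; the finitely many terms where xₙ may vanish are set to 0.
inv : (x : ℝ) → x # 0ℝ → ℝ
seq    (inv x x#0) n = recip (seq x n)
cauchy (inv x x#0@(δ , 0<δ , M , _)) ε 0<ε =
  let N , q = cauchy x ((δ ℚ.* δ) ℚ.* ε) (pos* (pos* 0<δ 0<δ) 0<ε)
  in M ⊔ N , λ m n ≤m ≤n → recip-bound (seq x m) (seq x n) 0<δ
       (apart-bound x x#0 m (left M N ≤m)) (apart-bound x x#0 n (left M N ≤n))
       (q m n (right M N ≤m) (right M N ≤n))

pointwise : ∀ {x y} → (∀ n → seq x n ≡ seq y n) → x ≈ y
pointwise {x} eq .close ε 0<ε = 0 , λ n _ →
  subst (λ q → ∣ seq x n ℚ.- q ∣ ℚ.< ε) (eq n) (∣p-p∣<ε (seq x n) 0<ε)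

private
  ≈-sym : ∀ {x y} → x ≈ y → y ≈ x
  ≈-sym {x} {y} p .close ε 0<ε =
    let N , q = close p ε 0<ε
    in N , λ n ≤n → subst (ℚ._< ε) (∣p-q∣≡∣q-p∣ (seq x n) (seq y n)) (q n ≤n)

  ≈-trans : ∀ {x y z} → x ≈ y → y ≈ z → x ≈ z
  ≈-trans {x} {y} {z} p q .close ε 0<ε =
    let M , p′ = close p (half ε) (0<half 0<ε)
        N , q′ = close q (half ε) (0<half 0<ε)
    in M ⊔ N , λ n ≤n → subst (λ r → ∣ r ∣ ℚ.< ε)
         (sub-sub (seq x n) (seq y n) (seq z n))
         (sum-bound (seq x n ℚ.- seq y n) (seq y n ℚ.- seq z n)
           (p′ n (left M N ≤n)) (q′ n (right M N ≤n)))

  +-cong : ∀ {x x′ y y′} → x ≈ x′ → y ≈ y′ → x + y ≈ x′ + y′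
  +-cong {x} {x′} {y} {y′} p q .close ε 0<ε =
    let M , p′ = close p (half ε) (0<half 0<ε)
        N , q′ = close q (half ε) (0<half 0<ε)
    in M ⊔ N , λ n ≤n → subst (λ r → ∣ r ∣ ℚ.< ε)
         (sub-+ (seq x n) (seq x′ n) (seq y n) (seq y′ n))
         (sum-bound (seq x n ℚ.- seq x′ n) (seq y n ℚ.- seq y′ n)
           (p′ n (left M N ≤n)) (q′ n (right M N ≤n)))

  -‿cong : ∀ {x y} → x ≈ y → - x ≈ - y
  -‿cong {x} {y} p .close ε 0<ε =
    let N , q = close (≈-sym p) ε 0<ε
    in N , λ n ≤n → subst (λ r → ∣ r ∣ ℚ.< ε) (sub-neg (seq x n) (seq y n)) (q n ≤n)

  *-cong : ∀ {x x′ y y′} → x ≈ x′ → y ≈ y′ → x * y ≈ x′ * y′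
  *-cong {x} {x′} {y} {y′} p q .close ε 0<ε =
    let A , 0<A , Na , a≤ = bounded x
        D , 0<D , Nd , d≤ = bounded y′
        M , p′ = close p (scale D (half ε)) (0<scale 0<D (0<half 0<ε))
        N , q′ = close q (scale A (half ε)) (0<scale 0<A (0<half 0<ε))
    in (Na ⊔ Nd) ⊔ (M ⊔ N) , λ n ≤n →
         let ≤l = left (Na ⊔ Nd) (M ⊔ N) ≤n
             ≤r = right (Na ⊔ Nd) (M ⊔ N) ≤n
         in product-bound (seq x n) (seq y n) (seq x′ n) (seq y′ n) 0<A 0<D
              (a≤ n (left Na Nd ≤l)) (d≤ n (right Na Nd ≤l))
              (p′ n (left M N ≤r)) (q′ n (right M N ≤r))

ℝ-isCommutativeRing : IsCommutativeRing _≈_ _+_ _*_ -_ 0ℝ 1ℝ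
ℝ-isCommutativeRing = record
  { isRing = record
    { +-isAbelianGroup = record
      { isGroup = record
        { isMonoid = record
          { isSemigroup = record
            { isMagma = record
              { isEquivalence = record { refl = pointwise (λ _ → refl) ; sym = ≈-sym ; trans = ≈-trans }
              ; ∙-cong = +-cong
              }
            ; assoc = λ x y z → pointwise (λ n → ℚ.+-assoc (seq x n) (seq y n) (seq z n))
            }
          ; identity = (λ x → pointwise (λ n → ℚ.+-identityˡ (seq x n)))
                     , (λ x → pointwise (λ n → ℚ.+-identityʳ (seq x n)))
          }
        ; inverse = (λ x → pointwise (λ n → ℚ.+-inverseˡ (seq x n)))
                  , (λ x → pointwise (λ n → ℚ.+-inverseʳ (seq x n)))
        ; ⁻¹-cong = -‿cong
        }
      ; comm = λ x y → pointwise (λ n → ℚ.+-comm (seq x n) (seq y n))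
      }
    ; *-cong = *-cong
    ; *-assoc = λ x y z → pointwise (λ n → ℚ.*-assoc (seq x n) (seq y n) (seq z n))
    ; *-identity = (λ x → pointwise (λ n → ℚ.*-identityˡ (seq x n)))
                 , (λ x → pointwise (λ n → ℚ.*-identityʳ (seq x n)))
    ; distrib = (λ x y z → pointwise (λ n → ℚ.*-distribˡ-+ (seq x n) (seq y n) (seq z n)))
              , (λ x y z → pointwise (λ n → ℚ.*-distribʳ-+ (seq x n) (seq y n) (seq z n)))
    }
  ; *-comm = λ x y → pointwise (λ n → ℚ.*-comm (seq x n) (seq y n))
  }

ℝ-commutativeRing : CommutativeRing 0ℓ 0ℓ
ℝ-commutativeRing = record { isCommutativeRing = ℝ-isCommutativeRing }

*-inverseʳ : ∀ x (x#0 : x # 0ℝ) → x * inv x x#0 ≈ 1ℝ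
*-inverseʳ x x#0@(δ , 0<δ , N , _) .close ε 0<ε = N , λ n N≤n →
  subst (λ q → ∣ q ℚ.- 1ℚ ∣ ℚ.< ε) (sym (recip-inverse (nz n N≤n))) (∣p-p∣<ε 1ℚ 0<ε)
  where
  nz : ∀ n → N ℕ.≤ n → seq x n ≢ 0ℚ
  nz n N≤n eq = ℚ.<⇒≢ (ℚ.<-≤-trans 0<δ (apart-bound x x#0 n N≤n)) (sym (cong ∣_∣ eq))

open Exp (CommutativeRing.semiring ℝ-commutativeRing) public using (_^_)
open Sum (CommutativeRing.semiring ℝ-commutativeRing) public using (sum-syntax)

-- ∑₁ n f = f 1 + ⋯ + f n  and  ∑₀ n f = f 0 + ⋯ + f n
∑₁ ∑₀ : ℕ → (ℕ → ℝ) → ℝ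
∑₁ n f = ∑[ i < n ] f (suc (toℕ i))
∑₀ n f = ∑[ i < suc n ] f (toℕ i)

------------------------------------------------------------------------
-- Factorials; ƛ stands for the parameter λ.

-- (x)_{k,λ}
deg-falling : ℝ → ℝ → ℕ → ℝ
deg-falling ƛ x zero    = 1ℝ
deg-falling ƛ x (suc k) = deg-falling ƛ x k * (x - fromℕ k * ƛ)

-- ⟨x⟩_{k,λ}
deg-rising : ℝ → ℝ → ℕ → ℝ
deg-rising ƛ x zero    = 1ℝ
deg-rising ƛ x (suc k) = deg-rising ƛ x k * (x + fromℕ k * ƛ)

-- (x)_k
falling : ℝ → ℕ → ℝ
falling x zero    = 1ℝ
falling x (suc k) = falling x k * (x - fromℕ k)

-- The generalised binomial coefficient (x)_k / k!
binomial : ℝ → ℕ → ℝ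
binomial x k = falling x k * fromℚ ((+ 1 / (k !)) {{k ℕ.!≢0}})

------------------------------------------------------------------------
-- Degenerate Stirling numbers of the second kind and harmonic numbers

-- The defining relation determines S n k for k ≤ n; the values for k > n are unconstrained.
IsDegStirling₂ : ℝ → (ℕ → ℕ → ℝ) → Set
IsDegStirling₂ ƛ S = ∀ n x → deg-falling ƛ x n ≈ ∑₀ n (λ k → S n k * falling x k)

-- The numbers exist: the recurrence S(n+1,k) = S(n,k-1) + (k - nλ) S(n,k) produces them.
deg-stirling₂ : ℝ → ℕ → ℕ → ℝ
deg-stirling₂ ƛ zero    zero    = 1ℝ
deg-stirling₂ ƛ zero    (suc k) = 0ℝ
deg-stirling₂ ƛ (suc n) zero    = (fromℕ 0 - fromℕ n * ƛ) * deg-stirling₂ ƛ n 0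
deg-stirling₂ ƛ (suc n) (suc k) =
  deg-stirling₂ ƛ n k + (fromℕ (suc k) - fromℕ n * ƛ) * deg-stirling₂ ƛ n (suc k)

module _ (ƛ : ℝ) where
  private
    module R = CommutativeRing ℝ-commutativeRing
    module Σ = Sum R.semiring
    open import Relation.Binary.Reasoning.Setoid R.setoid

    S = deg-stirling₂ ƛ

    vanish : ∀ n k → n ℕ.< k → S n k ≈ 0ℝ
    vanish zero    (suc k) _         = R.refl
    vanish (suc n) (suc k) (ℕ.s≤s p) = R.trans
      (R.+-cong (vanish n k p) (R.trans (R.*-congˡ (vanish n (suc k) (ℕ.m<n⇒m<1+n p))) (R.zeroʳ _)))
      (R.+-identityʳ 0ℝ)

    ∑₀-last : ∀ n f → ∑₀ (suc n) f ≈ ∑₀ n f + f (suc n)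
    ∑₀-last n f = R.trans (Σ.sum-init-last {suc n} (λ i → f (toℕ i)))
      (R.+-cong (Σ.sum-cong-≋ {suc n} (λ i → R.reflexive (cong f (Fin.toℕ-inject₁ i))))
                (R.reflexive (cong f (Fin.toℕ-fromℕ (suc n)))))

    split : ∀ x c d → x - d ≈ (x - c) + (c - d)
    split x c d = R.sym (R.trans (R.+-assoc x (- c) (c - d))
      (R.+-congˡ (R.trans (R.sym (R.+-assoc (- c) c (- d)))
        (R.trans (R.+-congʳ (R.-‿inverseˡ c)) (R.+-identityˡ (- d))))))

    module Step (n : ℕ) (x : ℝ) where
      T : ℕ → ℝ
      T k = (fromℕ k - fromℕ n * ƛ) * S n k

      f g h : ℕ → ℝ
      f k = S n k * falling x k
      g k = S n k * falling x (suc k)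
      h k = T k * falling x k

      term : ∀ k → f k * (x - fromℕ n * ƛ) ≈ g k + h k
      term k = begin
        (s * y) * (x - b)               ≈⟨ R.*-congˡ (split x a b) ⟩
        (s * y) * ((x - a) + (a - b))   ≈⟨ R.distribˡ (s * y) (x - a) (a - b) ⟩
        (s * y) * (x - a) + (s * y) * (a - b)
          ≈⟨ R.+-cong (R.*-assoc s y (x - a)) (R.trans (R.*-comm (s * y) (a - b)) (R.sym (R.*-assoc (a - b) s y))) ⟩
        s * (y * (x - a)) + ((a - b) * s) * y ∎
        where
        s = S n k
        y = falling x k
        a = fromℕ k
        b = fromℕ n * ƛ

      h-vanish : h (suc n) ≈ 0ℝ
      h-vanish = R.trans (R.*-congʳ (R.trans (R.*-congˡ (vanish n (suc n) ℕ.≤-refl)) (R.zeroʳ _))) (R.zeroˡ _)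

      step : ∑₀ n f * (x - fromℕ n * ƛ) ≈ ∑₀ (suc n) (λ k → S (suc n) k * falling x k)
      step = begin
        ∑₀ n f * (x - fromℕ n * ƛ)               ≈⟨ Σ.*-distribʳ-sum {suc n} (x - fromℕ n * ƛ) (λ i → f (toℕ i)) ⟩
        ∑₀ n (λ k → f k * (x - fromℕ n * ƛ))     ≈⟨ Σ.sum-cong-≋ {suc n} (λ i → term (toℕ i)) ⟩
        ∑₀ n (λ k → g k + h k)                   ≈⟨ Σ.∑-distrib-+ {suc n} (λ i → g (toℕ i)) (λ i → h (toℕ i)) ⟩
        ∑₀ n g + ∑₀ n h                          ≈⟨ R.+-congˡ (R.sym (R.trans (∑₀-last n h) (R.trans (R.+-congˡ h-vanish) (R.+-identityʳ (∑₀ n h))))) ⟩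
        ∑₀ n g + (h 0 + ∑₁ (suc n) h)            ≈⟨ R.+-assoc (∑₀ n g) (h 0) (∑₁ (suc n) h) ⟨
        (∑₀ n g + h 0) + ∑₁ (suc n) h            ≈⟨ R.+-congʳ (R.+-comm (∑₀ n g) (h 0)) ⟩
        (h 0 + ∑₀ n g) + ∑₁ (suc n) h            ≈⟨ R.+-assoc (h 0) (∑₀ n g) (∑₁ (suc n) h) ⟩
        h 0 + (∑₀ n g + ∑₁ (suc n) h)            ≈⟨ R.+-congˡ (Σ.∑-distrib-+ {suc n} (λ i → g (toℕ i)) (λ i → h (suc (toℕ i)))) ⟨
        h 0 + ∑₀ n (λ k → g k + h (suc k))       ≈⟨ R.+-congˡ (Σ.sum-cong-≋ {suc n} (λ i → R.sym (R.distribʳ (falling x (suc (toℕ i))) (S n (toℕ i)) (T (suc (toℕ i)))))) ⟩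
        ∑₀ (suc n) (λ k → S (suc n) k * falling x k) ∎

  deg-stirling₂-correct : IsDegStirling₂ ƛ (deg-stirling₂ ƛ)
  deg-stirling₂-correct zero    x = R.sym (R.trans (R.+-identityʳ (1ℝ * 1ℝ)) (R.*-identityʳ 1ℝ))
  deg-stirling₂-correct (suc n) x = R.trans (R.*-congʳ (deg-stirling₂-correct n x)) (Step.step n x)

deg-harmonic : (ƛ : ℝ) → ƛ # 0ℝ → ℕ → ℝ
deg-harmonic ƛ ƛ#0 n = ∑₁ n (λ k → inv ƛ ƛ#0 * binomial ƛ k * (- 1ℝ) ^ (k ℕ.∸ 1))

deg-hyperharmonic : (ƛ : ℝ) → ƛ # 0ℝ → (r : ℕ) → .{{ℕ.NonZero r}} → ℕ → ℝ
deg-hyperharmonic ƛ ƛ#0 1             n = deg-harmonic ƛ ƛ#0 n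
deg-hyperharmonic ƛ ƛ#0 (suc (suc r)) n = ∑₁ n (deg-hyperharmonic ƛ ƛ#0 (suc r))

{-# OPTIONS --safe #-}

-- Expanding (1/λ)(1 − (1−t)^λ)/(1−t)^r in powers of t shows that
--   (−1)^k k! H_{k,λ}^{(r)} = (1/λ) ((−r)_k − (λ−r)_k),
-- an instance, for each r, of Pascal's rule summed r times.  Hence, by the relation defining
-- S_{2,λ}, the left-hand side is (1/λ) ((−r)_{n,λ} − (λ−r)_{n,λ}), and the two products share
-- all their factors but one.

module Submission where

open import Defs
open import Data.Nat.Base using (ℕ; NonZero; _∸_; _!)
open import Data.Product.Base using (_×_)

open import Algebra.Bundles using (CommutativeRing)
import Algebra.Properties.Semiring.Exp as Exp
import Algebra.Properties.Semiring.Sum as Sum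
open import Data.Fin.Base using (toℕ)
import Data.Fin.Properties as Fin
open import Data.Integer.Base as ℤ using (+_)
import Data.Integer.Properties as ℤ
open import Data.Integer.Solver using () renaming (module +-*-Solver to ℤ-Solver)
open import Data.Nat.Base as ℕ using (zero; suc)
import Data.Nat.Properties as ℕ
open import Data.Product.Base using (_,_)
open import Data.Rational.Base as ℚ using (0ℚ; 1ℚ; _/_; toℚᵘ)
import Data.Rational.Properties as ℚ
open import Data.Rational.Solver using (module +-*-Solver)
open import Data.Rational.Unnormalised.Base as ℚᵘ using (mkℚᵘ; *≡*)
import Data.Rational.Unnormalised.Properties as ℚᵘ
open import Relation.Binary.PropositionalEquality using (_≡_; refl; cong; sym)

private
  module R = CommutativeRing ℝ-commutativeRing
  module Σ = Sum R.semiring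
  module E = Exp R.semiring

open import Relation.Binary.Reasoning.Setoid R.setoid
open +-*-Solver using (solve; _:+_; _:*_; _:-_; :-_; _:=_; con)

-- Embedding of the naturals

-- `_/_` divides out a gcd and is stuck on open terms. Unnormalised rationals compare by
-- cross-multiplication, which leaves integer identities.
toℚᵘ-/ : ∀ p d → toℚᵘ (p / suc d) ℚᵘ.≃ mkℚᵘ p d
toℚᵘ-/ p d = ℚ.toℚᵘ-fromℚᵘ (mkℚᵘ p d)

/1-homo-* : ∀ m n → + (m ℕ.* n) / 1 ≡ (+ m / 1) ℚ.* (+ n / 1)
/1-homo-* m n = ℚ.toℚᵘ-injective (ℚᵘ.≃-trans (toℚᵘ-/ (+ (m ℕ.* n)) 0) (ℚᵘ.≃-sym (ℚᵘ.≃-trans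
  (ℚ.toℚᵘ-homo-* (+ m / 1) (+ n / 1))
  (ℚᵘ.≃-trans (ℚᵘ.*-cong (toℚᵘ-/ (+ m) 0) (toℚᵘ-/ (+ n) 0))
    (*≡* (cong (ℤ._* + 1) (sym (ℤ.pos-* m n))))))))

/1-suc : ∀ n → + suc n / 1 ≡ (+ n / 1) ℚ.+ 1ℚ
/1-suc n = ℚ.toℚᵘ-injective (ℚᵘ.≃-trans (toℚᵘ-/ (+ suc n) 0) (ℚᵘ.≃-sym (ℚᵘ.≃-trans
  (ℚ.toℚᵘ-homo-+ (+ n / 1) 1ℚ)
  (ℚᵘ.≃-trans (ℚᵘ.+-congˡ (toℚᵘ 1ℚ) (toℚᵘ-/ (+ n) 0))
    (*≡* (ℤ-identity (+ n)))))))
  where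
  open ℤ-Solver renaming (solve to solveℤ; _:+_ to _⊕_; _:*_ to _⊗_; _:=_ to _≐_; con to conℤ)
  ℤ-identity : ∀ m → (m ℤ.* + 1 ℤ.+ + 1 ℤ.* + 1) ℤ.* + 1 ≡ (+ 1 ℤ.+ m) ℤ.* + 1
  ℤ-identity = solveℤ 1 (λ m → (m ⊗ conℤ (+ 1) ⊕ conℤ (+ 1) ⊗ conℤ (+ 1)) ⊗ conℤ (+ 1)
    ≐ (conℤ (+ 1) ⊕ m) ⊗ conℤ (+ 1)) refl

1/n*n≡1 : ∀ n .{{_ : NonZero n}} → (+ 1 / n) ℚ.* (+ n / 1) ≡ 1ℚ
1/n*n≡1 n@(suc d) = ℚ.toℚᵘ-injective (ℚᵘ.≃-trans
  (ℚ.toℚᵘ-homo-* (+ 1 / n) (+ n / 1))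
  (ℚᵘ.≃-trans (ℚᵘ.*-cong (toℚᵘ-/ (+ 1) d) (toℚᵘ-/ (+ n) 0))
    (*≡* (ℤ-identity (+ n)))))
  where
  open ℤ-Solver renaming (solve to solveℤ; _:*_ to _⊗_; _:=_ to _≐_; con to conℤ)
  ℤ-identity : ∀ m → (+ 1 ℤ.* m) ℤ.* + 1 ≡ + 1 ℤ.* (m ℤ.* + 1)
  ℤ-identity = solveℤ 1 (λ m → (conℤ (+ 1) ⊗ m) ⊗ conℤ (+ 1) ≐ conℤ (+ 1) ⊗ (m ⊗ conℤ (+ 1))) refl

fromℕ-suc : ∀ n → fromℕ (suc n) ≈ fromℕ n + 1ℝ
fromℕ-suc n = pointwise (λ _ → /1-suc n)

-- The second factor of `binomial`, so `binomial x k` unfolds to `falling x k * 1/ k !`.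
1/_! : ℕ → ℝ
1/ k ! = fromℚ ((+ 1 / (k !)) {{k ℕ.!≢0}})

1/k!*k!≈1 : ∀ k → 1/ k ! * fromℕ (k !) ≈ 1ℝ
1/k!*k!≈1 k = pointwise (λ _ → 1/n*n≡1 (k !) {{k ℕ.!≢0}})

-- Insert 1 = (k+1)!/(k+1)!, split (k+1)! as (k+1) k!, and cancel k!.
1/k!≈[1+k]/[1+k]! : ∀ k → 1/ k ! ≈ fromℕ (suc k) * 1/ suc k !
1/k!≈[1+k]/[1+k]! k = begin
  1/ k !                                            ≈⟨ R.*-identityʳ _ ⟨
  1/ k ! * 1ℝ                                       ≈⟨ R.*-congˡ (1/k!*k!≈1 (suc k)) ⟨
  1/ k ! * (1/ suc k ! * fromℕ (suc k ℕ.* k !))     ≈⟨ R.*-congˡ (R.*-congˡ (pointwise (λ _ → /1-homo-* (suc k) (k !)))) ⟩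
  1/ k ! * (1/ suc k ! * (fromℕ (suc k) * fromℕ (k !)))
    ≈⟨ rearrange (1/ k !) (1/ suc k !) (fromℕ (suc k)) (fromℕ (k !)) ⟩
  (1/ k ! * fromℕ (k !)) * (fromℕ (suc k) * 1/ suc k !) ≈⟨ R.*-congʳ (1/k!*k!≈1 k) ⟩
  1ℝ * (fromℕ (suc k) * 1/ suc k !)                 ≈⟨ R.*-identityˡ _ ⟩
  fromℕ (suc k) * 1/ suc k !                        ∎
  where
  -- Real operations act termwise on sequences, so a polynomial identity solved over ℚ at each index
  -- holds in ℝ.
  rearrange : ∀ a b c d → a * (b * (c * d)) ≈ (a * d) * (c * b)
  rearrange a b c d = pointwise λ i → solve 4
    (λ a b c d → a :* (b :* (c :* d)) := (a :* d) :* (c :* b)) refl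
    (seq a i) (seq b i) (seq c i) (seq d i)

-- Finite sums and signs

-- Applied to ∑₁ with f k the summand at suc k, so that f and g can be inferred.
∑-cong : ∀ n {f g : ℕ → ℝ} → (∀ k → k ℕ.< n → f k ≈ g k) → ∑[ i < n ] f (toℕ i) ≈ ∑[ i < n ] g (toℕ i)
∑-cong n f≈g = Σ.sum-cong-≋ {n} (λ i → f≈g (toℕ i) (Fin.toℕ<n i))

∑₁-last : ∀ n (f : ℕ → ℝ) → ∑₁ (suc n) f ≈ ∑₁ n f + f (suc n)
∑₁-last n f = R.trans (Σ.sum-init-last {n} (λ i → f (suc (toℕ i))))
  (R.+-cong (Σ.sum-cong-≋ {n} (λ i → R.reflexive (cong (λ j → f (suc j)) (Fin.toℕ-inject₁ i))))
            (R.reflexive (cong (λ j → f (suc j)) (Fin.toℕ-fromℕ n))))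

∑₁-distribˡ : ∀ n c (f : ℕ → ℝ) → ∑₁ n (λ k → c * f k) ≈ c * ∑₁ n f
∑₁-distribˡ n c f = R.sym (Σ.*-distribˡ-sum {n} c (λ i → f (suc (toℕ i))))

∑₁-distrib-- : ∀ n (f g : ℕ → ℝ) → ∑₁ n (λ k → f k - g k) ≈ ∑₁ n f - ∑₁ n g
∑₁-distrib-- zero    f g = R.sym (R.-‿inverseʳ 0ℝ)
∑₁-distrib-- (suc n) f g = R.trans
  (R.+-congˡ (∑₁-distrib-- n (λ k → f (suc k)) (λ k → g (suc k))))
  (rearrange (f 1) (g 1) (∑₁ n (λ k → f (suc k))) (∑₁ n (λ k → g (suc k))))
  where
  rearrange : ∀ a b c d → (a - b) + (c - d) ≈ (a + c) - (b + d)
  rearrange a b c d = pointwise λ i → solve 4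
    (λ a b c d → (a :- b) :+ (c :- d) := (a :+ c) :- (b :+ d)) refl
    (seq a i) (seq b i) (seq c i) (seq d i)

sign : ℕ → ℝ
sign k = (- 1ℝ) ^ k

sign*sign≈1 : ∀ k → sign k * sign k ≈ 1ℝ
sign*sign≈1 zero    = R.*-identityʳ 1ℝ
sign*sign≈1 (suc k) = R.trans (cancel (sign k)) (sign*sign≈1 k)
  where
  cancel : ∀ a → (- 1ℝ * a) * (- 1ℝ * a) ≈ a * a
  cancel a = pointwise λ i → solve 1
    (λ a → (:- con 1ℚ :* a) :* (:- con 1ℚ :* a) := a :* a) refl (seq a i)

-- Multiplying by `sign k * sign k`, which is 1, turns the truncated subtraction into the sum n - k
-- + k.
sign-∸ : ∀ {n k} → k ℕ.≤ n → sign (n ∸ k) ≈ sign n * sign k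
sign-∸ {n} {k} k≤n = begin
  sign (n ∸ k)                        ≈⟨ R.*-identityʳ _ ⟨
  sign (n ∸ k) * 1ℝ                   ≈⟨ R.*-congˡ (sign*sign≈1 k) ⟨
  sign (n ∸ k) * (sign k * sign k)    ≈⟨ R.*-assoc _ _ _ ⟨
  (sign (n ∸ k) * sign k) * sign k    ≈⟨ R.*-congʳ (E.^-homo-* (- 1ℝ) (n ∸ k) k) ⟨
  sign (n ∸ k ℕ.+ k) * sign k         ≈⟨ R.*-congʳ (E.^-congʳ (- 1ℝ) (ℕ.m∸n+n≡m k≤n)) ⟩
  sign n * sign k                     ∎

-- Factorial polynomials

-- After the first factor y, the factors y - λ, y - 2λ, ... are x, x - λ, ...
deg-falling-shift : ∀ ƛ {x y} → y ≈ x + ƛ → ∀ n →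
  deg-falling ƛ y (suc n) ≈ y * deg-falling ƛ x n
deg-falling-shift ƛ {x} {y} y≈ zero = pointwise λ i → solve 2
  (λ y l → con 1ℚ :* (y :- con 0ℚ :* l) := y :* con 1ℚ) refl (seq y i) (seq ƛ i)
deg-falling-shift ƛ {x} {y} y≈ (suc n) = begin
  deg-falling ƛ y (suc n) * (y - fromℕ (suc n) * ƛ)
    ≈⟨ R.*-cong (deg-falling-shift ƛ y≈ n) (R.+-cong y≈ (R.-‿cong (R.*-congʳ (fromℕ-suc n)))) ⟩
  (y * deg-falling ƛ x n) * ((x + ƛ) - (fromℕ n + 1ℝ) * ƛ)
    ≈⟨ rearrange y (deg-falling ƛ x n) x ƛ (fromℕ n) ⟩
  y * (deg-falling ƛ x n * (x - fromℕ n * ƛ)) ∎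
  where
  rearrange : ∀ y d x l m → (y * d) * ((x + l) - (m + 1ℝ) * l) ≈ y * (d * (x - m * l))
  rearrange y d x l m = pointwise λ i → solve 5
    (λ y d x l m → (y :* d) :* ((x :+ l) :- (m :+ con 1ℚ) :* l) := y :* (d :* (x :- m :* l))) refl
    (seq y i) (seq d i) (seq x i) (seq l i) (seq m i)

-- Both products contain (x)_{n,λ}; the factors left over, x - nλ and x + λ, differ by -(n+1)λ.
deg-falling-difference : ∀ ƛ {x y} → y ≈ x + ƛ → ∀ n →
  deg-falling ƛ x (suc n) - deg-falling ƛ y (suc n) ≈ - (deg-falling ƛ x n * (fromℕ (suc n) * ƛ))
deg-falling-difference ƛ {x} {y} y≈ n = begin
  d * (x - fromℕ n * ƛ) - deg-falling ƛ y (suc n)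
    ≈⟨ R.+-congˡ (R.-‿cong (R.trans (deg-falling-shift ƛ y≈ n) (R.*-congʳ y≈))) ⟩
  d * (x - fromℕ n * ƛ) - (x + ƛ) * d
    ≈⟨ rearrange d x ƛ (fromℕ n) ⟩
  - (d * ((fromℕ n + 1ℝ) * ƛ))
    ≈⟨ R.-‿cong (R.*-congˡ (R.*-congʳ (fromℕ-suc n))) ⟨
  - (d * (fromℕ (suc n) * ƛ)) ∎
  where
  d = deg-falling ƛ x n
  rearrange : ∀ d x l m → d * (x - m * l) - (x + l) * d ≈ - (d * ((m + 1ℝ) * l))
  rearrange d x l m = pointwise λ i → solve 4
    (λ d x l m → d :* (x :- m :* l) :- (x :+ l) :* d := :- (d :* ((m :+ con 1ℚ) :* l))) refl
    (seq d i) (seq x i) (seq l i) (seq m i)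

deg-falling-neg : ∀ ƛ x n → deg-falling ƛ (- x) n ≈ sign n * deg-rising ƛ x n
deg-falling-neg ƛ x zero    = R.sym (R.*-identityʳ 1ℝ)
deg-falling-neg ƛ x (suc n) = R.trans
  (R.*-congʳ (deg-falling-neg ƛ x n))
  (rearrange (sign n) (deg-rising ƛ x n) x (fromℕ n * ƛ))
  where
  rearrange : ∀ s d x m → (s * d) * (- x - m) ≈ (- 1ℝ * s) * (d * (x + m))
  rearrange s d x m = pointwise λ i → solve 4
    (λ s d x m → (s :* d) :* (:- x :- m) := (:- con 1ℚ :* s) :* (d :* (x :+ m))) refl
    (seq s i) (seq d i) (seq x i) (seq m i)

-- The case λ = 1, through which `falling` inherits the shift rule.
falling≈deg-falling : ∀ x k → falling x k ≈ deg-falling 1ℝ x k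
falling≈deg-falling x zero    = R.refl
falling≈deg-falling x (suc k) =
  R.*-cong (falling≈deg-falling x k) (R.+-congˡ (R.-‿cong (R.sym (R.*-identityʳ (fromℕ k)))))

falling-shift : ∀ {x y} → y ≈ x + 1ℝ → ∀ k → falling y (suc k) ≈ y * falling x k
falling-shift {x} {y} y≈ k = R.trans (falling≈deg-falling y (suc k))
  (R.trans (deg-falling-shift 1ℝ y≈ k) (R.*-congˡ (R.sym (falling≈deg-falling x k))))

-- Hyperharmonic numbers as differences of signed binomial coefficients

-- The shift gives (x+1)(x)_k in the numerator; split x + 1 as (k+1) + (x-k).
pascal : ∀ {x y} → y ≈ x + 1ℝ → ∀ k → binomial y (suc k) ≈ binomial x k + binomial x (suc k)
pascal {x} {y} y≈ k = begin
  falling y (suc k) * ρ                                 ≈⟨ R.*-congʳ (R.trans (falling-shift y≈ k) (R.*-congʳ y≈)) ⟩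
  ((x + 1ℝ) * f) * ρ                                    ≈⟨ rearrange x f ρ (fromℕ k) ⟩
  f * ((fromℕ k + 1ℝ) * ρ) + (f * (x - fromℕ k)) * ρ    ≈⟨ R.+-congʳ (R.*-congˡ (R.*-congʳ (fromℕ-suc k))) ⟨
  f * (fromℕ (suc k) * ρ) + (f * (x - fromℕ k)) * ρ     ≈⟨ R.+-congʳ (R.*-congˡ (1/k!≈[1+k]/[1+k]! k)) ⟨
  f * 1/ k ! + (f * (x - fromℕ k)) * ρ                  ∎
  where
  f = falling x k
  ρ = 1/ suc k !
  rearrange : ∀ x f r m → ((x + 1ℝ) * f) * r ≈ f * ((m + 1ℝ) * r) + (f * (x - m)) * r
  rearrange x f r m = pointwise λ i → solve 4
    (λ x f r m → ((x :+ con 1ℚ) :* f) :* r := f :* ((m :+ con 1ℚ) :* r) :+ (f :* (x :- m)) :* r) refl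
    (seq x i) (seq f i) (seq r i) (seq m i)

-- The coefficient of t^k in (1-t)^x - (1-t)^y.
signed-difference : ℝ → ℝ → ℕ → ℝ
signed-difference x y k = sign k * (binomial x k - binomial y k)

-- By Pascal's rule each summand is the value at k minus the value at k - 1 of
-- `signed-difference x y`, so the sum telescopes. On generating functions this is division by 1 -
-- t.
∑₁-signed-difference : ∀ {x y x′ y′} → x′ ≈ x + 1ℝ → y′ ≈ y + 1ℝ → ∀ n →
  ∑₁ n (signed-difference x′ y′) ≈ signed-difference x y n
-- The lower end contributes nothing: `binomial x 0` and `binomial y 0` are the same term.
∑₁-signed-difference {x} {y} x≈ y≈ zero = R.sym
  (R.trans (R.*-congˡ (R.-‿inverseʳ (binomial x 0))) (R.zeroʳ 1ℝ))
∑₁-signed-difference {x} {y} {x′} {y′} x≈ y≈ (suc n) = begin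
  ∑₁ (suc n) (signed-difference x′ y′)
    ≈⟨ ∑₁-last n (signed-difference x′ y′) ⟩
  ∑₁ n (signed-difference x′ y′) + signed-difference x′ y′ (suc n)
    ≈⟨ R.+-cong (∑₁-signed-difference x≈ y≈ n)
         (R.*-congˡ (R.+-cong (pascal x≈ n) (R.-‿cong (pascal y≈ n)))) ⟩
  signed-difference x y n
    + sign (suc n) * ((binomial x n + binomial x (suc n)) - (binomial y n + binomial y (suc n)))
    ≈⟨ rearrange (sign n) (binomial x n) (binomial y n) (binomial x (suc n)) (binomial y (suc n)) ⟩
  signed-difference x y (suc n) ∎
  where
  rearrange : ∀ s a b c d →
    s * (a - b) + (- 1ℝ * s) * ((a + c) - (b + d)) ≈ (- 1ℝ * s) * (c - d)
  rearrange s a b c d = pointwise λ i → solve 5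
    (λ s a b c d → s :* (a :- b) :+ (:- con 1ℚ :* s) :* ((a :+ c) :- (b :+ d))
      := (:- con 1ℚ :* s) :* (c :- d)) refl
    (seq s i) (seq a i) (seq b i) (seq c i) (seq d i)

-- Writing 0 as -1 + 1, the shift pulls out a factor 0.
binomial-0 : ∀ k → binomial 0ℝ (suc k) ≈ 0ℝ
binomial-0 k = R.trans
  (R.*-congʳ (R.trans (falling-shift (R.sym (R.-‿inverseˡ 1ℝ)) k) (R.zeroˡ (falling (- 1ℝ) k))))
  (R.zeroˡ (1/ suc k !))

module _ (ƛ : ℝ) (ƛ#0 : ƛ # 0ℝ) where

  private
    ƛ⁻¹ = inv ƛ ƛ#0
    -[_] ƛ-[_] : ℕ → ℝ
    -[ r ]  = - fromℕ r
    ƛ-[ r ] = ƛ - fromℕ r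

    -[_]-suc : ∀ r → -[ r ] ≈ -[ suc r ] + 1ℝ
    -[ r ]-suc = R.trans (rearrange (fromℕ r)) (R.+-congʳ (R.-‿cong (R.sym (fromℕ-suc r))))
      where
      rearrange : ∀ m → - m ≈ - (m + 1ℝ) + 1ℝ
      rearrange m = pointwise λ i → solve 1
        (λ m → :- m := :- (m :+ con 1ℚ) :+ con 1ℚ) refl (seq m i)

    ƛ-[_]-suc : ∀ r → ƛ-[ r ] ≈ ƛ-[ suc r ] + 1ℝ
    ƛ-[ r ]-suc = R.trans (R.+-congˡ -[ r ]-suc) (R.sym (R.+-assoc ƛ -[ suc r ] 1ℝ))

  -- Each summation lowers both arguments by 1. The start is r = 1, itself one summation of
  -- differences at the arguments 0 and λ.
  deg-hyperharmonic-closed : ∀ r n →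
    deg-hyperharmonic ƛ ƛ#0 (suc r) n ≈ ƛ⁻¹ * signed-difference -[ suc r ] ƛ-[ suc r ] n
  deg-hyperharmonic-closed zero n = begin
    ∑₁ n (λ k → ƛ⁻¹ * binomial ƛ k * sign (k ∸ 1))
      ≈⟨ ∑-cong n (λ k _ → term k) ⟩
    ∑₁ n (λ k → ƛ⁻¹ * signed-difference 0ℝ ƛ k)
      ≈⟨ ∑₁-distribˡ n ƛ⁻¹ (signed-difference 0ℝ ƛ) ⟩
    ƛ⁻¹ * ∑₁ n (signed-difference 0ℝ ƛ)
      ≈⟨ R.*-congˡ (∑₁-signed-difference
           (R.trans 0≈-0 -[ 0 ]-suc)
           (R.trans (R.trans (R.sym (R.+-identityʳ ƛ)) (R.+-congˡ 0≈-0)) ƛ-[ 0 ]-suc) n) ⟩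
    ƛ⁻¹ * signed-difference -[ 1 ] ƛ-[ 1 ] n ∎
    where
    0≈-0 : 0ℝ ≈ -[ 0 ]
    0≈-0 = pointwise (λ _ → refl)
    rearrange : ∀ l b s → l * b * s ≈ l * ((- 1ℝ * s) * (0ℝ - b))
    rearrange l b s = pointwise λ i → solve 3
      (λ l b s → l :* b :* s := l :* ((:- con 1ℚ :* s) :* (con 0ℚ :- b))) refl
      (seq l i) (seq b i) (seq s i)
    -- At index k + 1 the definition has the sign (-1)^k; the extra -1 is absorbed by the reversed
    -- difference 0 - b.
    term : ∀ k → ƛ⁻¹ * binomial ƛ (suc k) * sign k ≈ ƛ⁻¹ * signed-difference 0ℝ ƛ (suc k)
    term k = R.trans (rearrange ƛ⁻¹ (binomial ƛ (suc k)) (sign k))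
      (R.*-congˡ (R.*-congˡ (R.+-congʳ (R.sym (binomial-0 k)))))
  deg-hyperharmonic-closed (suc r) n = begin
    ∑₁ n (deg-hyperharmonic ƛ ƛ#0 (suc r))
      ≈⟨ ∑-cong n (λ k _ → deg-hyperharmonic-closed r (suc k)) ⟩
    ∑₁ n (λ k → ƛ⁻¹ * signed-difference -[ suc r ] ƛ-[ suc r ] k)
      ≈⟨ ∑₁-distribˡ n ƛ⁻¹ (signed-difference -[ suc r ] ƛ-[ suc r ]) ⟩
    ƛ⁻¹ * ∑₁ n (signed-difference -[ suc r ] ƛ-[ suc r ])
      ≈⟨ R.*-congˡ (∑₁-signed-difference -[ suc r ]-suc ƛ-[ suc r ]-suc n) ⟩
    ƛ⁻¹ * signed-difference -[ suc (suc r) ] ƛ-[ suc (suc r) ] n ∎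

  -- The two signs cancel and k! clears both denominators, leaving the falling factorials that the
  -- relation for `S` expands.
  sign*hyperharmonic*k! : ∀ r k → sign k * deg-hyperharmonic ƛ ƛ#0 (suc r) k * fromℕ (k !)
    ≈ ƛ⁻¹ * (falling -[ suc r ] k - falling ƛ-[ suc r ] k)
  sign*hyperharmonic*k! r k = begin
    sign k * deg-hyperharmonic ƛ ƛ#0 (suc r) k * fromℕ (k !)
      ≈⟨ R.*-congʳ (R.*-congˡ (deg-hyperharmonic-closed r k)) ⟩
    sign k * (ƛ⁻¹ * (sign k * (f * 1/ k ! - g * 1/ k !))) * fromℕ (k !)
      ≈⟨ rearrange (sign k) ƛ⁻¹ f g (1/ k !) (fromℕ (k !)) ⟩
    (sign k * sign k) * (1/ k ! * fromℕ (k !)) * (ƛ⁻¹ * (f - g))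
      ≈⟨ R.*-congʳ (R.*-cong (sign*sign≈1 k) (1/k!*k!≈1 k)) ⟩
    1ℝ * 1ℝ * (ƛ⁻¹ * (f - g))
      ≈⟨ R.trans (R.*-congʳ (R.*-identityʳ 1ℝ)) (R.*-identityˡ (ƛ⁻¹ * (f - g))) ⟩
    ƛ⁻¹ * (f - g) ∎
    where
    f = falling -[ suc r ] k
    g = falling ƛ-[ suc r ] k
    rearrange : ∀ s l f g a b →
      s * (l * (s * (f * a - g * a))) * b ≈ (s * s) * (a * b) * (l * (f - g))
    rearrange s l f g a b = pointwise λ i → solve 6
      (λ s l f g a b → s :* (l :* (s :* (f :* a :- g :* a))) :* b
        := (s :* s) :* (a :* b) :* (l :* (f :- g))) refl
      (seq s i) (seq l i) (seq f i) (seq g i) (seq a i) (seq b i)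

  -- Summation against the degenerate Stirling numbers

  module _ (S : ℕ → ℕ → ℝ) (isS : IsDegStirling₂ ƛ S) where

    -- The defining relation starts at k = 0, but that term, `S n 0 * 1ℝ`, does not depend on the
    -- argument and cancels in the difference.
    ∑₁-stirling-difference : ∀ n x y →
      ∑₁ n (λ k → S n k * falling x k) - ∑₁ n (λ k → S n k * falling y k)
        ≈ deg-falling ƛ x n - deg-falling ƛ y n
    ∑₁-stirling-difference n x y = R.trans
      (rearrange (S n 0 * 1ℝ) (∑₁ n (λ k → S n k * falling x k)) (∑₁ n (λ k → S n k * falling y k)))
      (R.+-cong (R.sym (isS n x)) (R.-‿cong (R.sym (isS n y))))
      where
      rearrange : ∀ a b c → b - c ≈ (a + b) - (a + c)
      rearrange a b c = pointwise λ i → solve 3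
        (λ a b c → b :- c := (a :+ b) :- (a :+ c)) refl (seq a i) (seq b i) (seq c i)

    hyperharmonic-stirling-sum : ∀ n r →
      ∑₁ (suc n) (λ k → sign k * deg-hyperharmonic ƛ ƛ#0 (suc r) k * fromℕ (k !) * S (suc n) k)
        ≈ sign (suc n) * deg-rising ƛ (fromℕ (suc r)) n * fromℕ (suc n)
    hyperharmonic-stirling-sum n r = begin
      ∑₁ N (λ k → sign k * deg-hyperharmonic ƛ ƛ#0 (suc r) k * fromℕ (k !) * S N k)
        ≈⟨ ∑-cong N (λ k _ → term (suc k)) ⟩
      ∑₁ N (λ k → ƛ⁻¹ * (S N k * falling x k - S N k * falling y k))
        ≈⟨ ∑₁-distribˡ N ƛ⁻¹ (λ k → S N k * falling x k - S N k * falling y k) ⟩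
      ƛ⁻¹ * ∑₁ N (λ k → S N k * falling x k - S N k * falling y k)
        ≈⟨ R.*-congˡ (R.trans
             (∑₁-distrib-- N (λ k → S N k * falling x k) (λ k → S N k * falling y k))
             (∑₁-stirling-difference N x y)) ⟩
      ƛ⁻¹ * (deg-falling ƛ x N - deg-falling ƛ y N)
        -- Here y = λ - r unfolds to λ + x, so commutativity gives y ≈ x + λ.
        ≈⟨ R.*-congˡ (deg-falling-difference ƛ (R.+-comm ƛ x) n) ⟩
      ƛ⁻¹ * - (deg-falling ƛ x n * (fromℕ N * ƛ))
        ≈⟨ R.*-congˡ (R.-‿cong (R.*-congʳ (deg-falling-neg ƛ (fromℕ (suc r)) n))) ⟩
      ƛ⁻¹ * - ((sign n * d) * (fromℕ N * ƛ))
        -- The outer minus raises the sign from (-1)^n to (-1)^(n+1), and λ meets its inverse.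
        ≈⟨ rearrange ƛ⁻¹ (sign n) d (fromℕ N) ƛ ⟩
      (ƛ * ƛ⁻¹) * (sign N * d * fromℕ N)
        ≈⟨ R.trans (R.*-congʳ (*-inverseʳ ƛ ƛ#0)) (R.*-identityˡ _) ⟩
      sign N * d * fromℕ N ∎
      where
      N = suc n
      x = -[ suc r ]
      y = ƛ-[ suc r ]
      d = deg-rising ƛ (fromℕ (suc r)) n
      distrib : ∀ l a b s → l * (a - b) * s ≈ l * (s * a - s * b)
      distrib l a b s = pointwise λ i → solve 4
        (λ l a b s → l :* (a :- b) :* s := l :* (s :* a :- s :* b)) refl
        (seq l i) (seq a i) (seq b i) (seq s i)
      term : ∀ k → sign k * deg-hyperharmonic ƛ ƛ#0 (suc r) k * fromℕ (k !) * S N k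
        ≈ ƛ⁻¹ * (S N k * falling x k - S N k * falling y k)
      term k = R.trans (R.*-congʳ (sign*hyperharmonic*k! r k))
        (distrib ƛ⁻¹ (falling x k) (falling y k) (S N k))
      rearrange : ∀ v s d m l → v * - ((s * d) * (m * l)) ≈ (l * v) * ((- 1ℝ * s) * d * m)
      rearrange v s d m l = pointwise λ i → solve 5
        (λ v s d m l → v :* :- ((s :* d) :* (m :* l)) := (l :* v) :* ((:- con 1ℚ :* s) :* d :* m)) refl
        (seq v i) (seq s i) (seq d i) (seq m i) (seq l i)

    harmonic-stirling-sum : ∀ n (nz : deg-rising ƛ 1ℝ n # 0ℝ) →
      inv (deg-rising ƛ 1ℝ n) nz
        * ∑₁ (suc n) (λ k → sign (suc n ∸ k) * deg-harmonic ƛ ƛ#0 k * fromℕ (k !) * S (suc n) k)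
        ≈ fromℕ (suc n)
    harmonic-stirling-sum n nz = begin
      d⁻¹ * ∑₁ N (λ k → sign (N ∸ k) * deg-harmonic ƛ ƛ#0 k * fromℕ (k !) * S N k)
        -- The range of summation supplies k ≤ N, needed to split (-1)^(N-k).
        ≈⟨ R.*-congˡ (∑-cong N term) ⟩
      d⁻¹ * ∑₁ N (λ k → sign N * (sign k * deg-harmonic ƛ ƛ#0 k * fromℕ (k !) * S N k))
        ≈⟨ R.*-congˡ (∑₁-distribˡ N (sign N) (λ k → sign k * deg-harmonic ƛ ƛ#0 k * fromℕ (k !) * S N k)) ⟩
      d⁻¹ * (sign N * ∑₁ N (λ k → sign k * deg-harmonic ƛ ƛ#0 k * fromℕ (k !) * S N k))
        -- The case r = 1; `fromℕ 1` computes to `1ℝ`.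
        ≈⟨ R.*-congˡ (R.*-congˡ (hyperharmonic-stirling-sum n 0)) ⟩
      d⁻¹ * (sign N * (sign N * d * fromℕ N))
        ≈⟨ rearrange d⁻¹ (sign N) d (fromℕ N) ⟩
      (d * d⁻¹) * (sign N * sign N) * fromℕ N
        ≈⟨ R.*-congʳ (R.*-cong (*-inverseʳ d nz) (sign*sign≈1 N)) ⟩
      1ℝ * 1ℝ * fromℕ N
        ≈⟨ R.trans (R.*-congʳ (R.*-identityʳ 1ℝ)) (R.*-identityˡ (fromℕ N)) ⟩
      fromℕ N ∎
      where
      N = suc n
      d = deg-rising ƛ 1ℝ n
      d⁻¹ = inv d nz
      assoc₅ : ∀ a b c e f → (a * b) * c * e * f ≈ a * (b * c * e * f)
      assoc₅ a b c e f = pointwise λ i → solve 5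
        (λ a b c e f → (a :* b) :* c :* e :* f := a :* (b :* c :* e :* f)) refl
        (seq a i) (seq b i) (seq c i) (seq e i) (seq f i)
      term : ∀ j → j ℕ.< N → let k = suc j in
        sign (N ∸ k) * deg-harmonic ƛ ƛ#0 k * fromℕ (k !) * S N k
          ≈ sign N * (sign k * deg-harmonic ƛ ƛ#0 k * fromℕ (k !) * S N k)
      term j j<N = R.trans
        (R.*-congʳ (R.*-congʳ (R.*-congʳ (sign-∸ {N} {suc j} j<N))))
        (assoc₅ (sign N) (sign (suc j)) (deg-harmonic ƛ ƛ#0 (suc j)) (fromℕ (suc j !)) (S N (suc j)))
      rearrange : ∀ v s d m → v * (s * (s * d * m)) ≈ (d * v) * (s * s) * m
      rearrange v s d m = pointwise λ i → solve 4
        (λ v s d m → v :* (s :* (s :* d :* m)) := (d :* v) :* (s :* s) :* m) refl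
        (seq v i) (seq s i) (seq d i) (seq m i)

theorem2 : (ƛ : ℝ) (ƛ#0 : ƛ # 0ℝ) (S : ℕ → ℕ → ℝ) → IsDegStirling₂ ƛ S →
    (∀ (n r : ℕ) .{{_ : NonZero n}} .{{_ : NonZero r}} →
    ∑₁ n (λ k → (- 1ℝ) ^ k * deg-hyperharmonic ƛ ƛ#0 r k * fromℕ (k !) * S n k)
    ≈ (- 1ℝ) ^ n * deg-rising ƛ (fromℕ r) (n ∸ 1) * fromℕ n)
    ×
    (∀ (n : ℕ) .{{_ : NonZero n}} (nz : deg-rising ƛ 1ℝ (n ∸ 1) # 0ℝ) →
    inv (deg-rising ƛ 1ℝ (n ∸ 1)) nz
    * ∑₁ n (λ k → (- 1ℝ) ^ (n ∸ k) * deg-harmonic ƛ ƛ#0 k * fromℕ (k !) * S n k)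
    ≈ fromℕ n)
theorem2 ƛ ƛ#0 S isS =
    (λ { (suc n) (suc r) → hyperharmonic-stirling-sum ƛ ƛ#0 S isS n r })
  , (λ { (suc n) nz → harmonic-stirling-sum ƛ ƛ#0 S isS n nz })
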